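{- Let $\mathcal{S}$ be a structural abstract logic in a propositional language $\mathcal{L}$. If $\mathcal{S}$ is uniform, then its Lindenbaum atlas $\mathbf{Lin}_{\mathcal{S}}[\Sigma_{\mathcal{S}}]$ is uniform.
   Context: $\mathcal{L}$ is an abstract propositional language, given by a set $\mathcal{V}_{\mathcal{L}}$ of variables, a set of constants and a set of finitary connectives. $\mathbf{Fm}_{\mathcal{L}}$ is the set of all $\mathcal{L}$-formulae, also viewed as the formula algebra; $\mathcal{V}(\alpha)$ is the set of variables occurring in $\alpha$, and $\mathcal{V}(X)=\bigcup_{\alpha\in X}\mathcal{V}(\alpha)$ for $X\subseteq\mathbf{Fm}_{\mathcal{L}}$. For $\mathcal{V}\subseteq\mathcal{V}_{\mathcal{L}}$, $\mathbf{Fm}_{\mathcal{L}}[\mathcal{V}]=\{\alpha\in\mathbf{Fm}_{\mathcal{L}} : \mathcal{V}(\alpha)\subseteq\mathcal{V}\}$. A structural abstract logic $\mathcal{S}$ is given by a (not necessarily finitary) consequence relation $\vdash_{\mathcal{S}}$ on $\mathbf{Fm}_{\mathcal{L}}$ (reflexive, monotone, transitive/closed under cut) closed under substitutions, equivalently by its consequence operator $\mathbf{Cn}_{\mathcal{S}}(X)=\{\alpha : X\vdash_{\mathcal{S}}\alpha\}$. An $\mathcal{S}$-theory is a set $X\subseteq\mathbf{Fm}_{\mathcal{L}}$ with $\mathbf{Cn}_{\mathcal{S}}(X)=X$; $\Sigma_{\mathcal{S}}$ is the set of all $\mathcal{S}$-theories. $\mathcal{S}$ is uniform if for all $X,Y\subseteq\mathbf{Fm}_{\mathcal{L}}$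 and $\alpha\in\mathbf{Fm}_{\mathcal{L}}$ such that $\mathcal{V}(X\cup\{\alpha\})\cap\mathcal{V}(Y)=\varnothing$ and $Y$ is consistent (i.e. $\mathbf{Cn}_{\mathcal{S}}(Y)\neq\mathbf{Fm}_{\mathcal{L}}$): $X\cup Y\vdash_{\mathcal{S}}\alpha$ implies $X\vdash_{\mathcal{S}}\alpha$. An $\mathcal{L}$-matrix is a pair $\mathbf{M}=\langle\mathbf{A},D\rangle$ with $\mathbf{A}$ an algebra of the signature of $\mathcal{L}$ and $D\subseteq|\mathbf{A}|$ (its logical filter). A valuation in $\mathbf{A}$ is a homomorphism from the formula algebra to $\mathbf{A}$. $\mathfrak{S}(\mathbf{M})$ is the set of all $X\subseteq\mathbf{Fm}_{\mathcal{L}}$ such that $X=\{\alpha\in\mathbf{Fm}_{\mathcal{L}} : v[\alpha]\in D\}$ for some valuation $v$ in $\mathbf{A}$. A nonempty family of $\mathcal{L}$-matrices is a bundle if its algebras are pairwise isomorphic. An atlas is a pair $\langle\mathbf{A},\{D_i\}_{i\in I}\rangle$ with each $D_i\subseteq|\mathbf{A}|$; its corresponding bundle is $\{\langle\mathbf{A},D_i\rangle\}_{i\in I}$. The Lindenbaum atlas of $\mathcal{S}$ is $\mathbf{Lin}_{\mathcal{S}}[\Sigma_{\mathcal{S}}]=\langle\mathbf{Fm}_{\mathcal{L}},\Sigma_{\mathcal{S}}\rangle$. A bundle $\{\mathbf{M}_i\}_{i\in I}$ is uniform if for all $X,Y\subseteq\mathbf{Fm}_{\mathcal{L}}$ with $X\subseteq\mathbf{Fm}_{\mathcal{L}}[\mathcal{V}_{\mathcal{L}}\setminus\mathcal{V}(Y)]$,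 all $i,j\in I$, all $Z_i\in\mathfrak{S}(\mathbf{M}_i)$ and $Z_j\in\mathfrak{S}(\mathbf{M}_j)$, there are $k\in I$ and $Z_k\in\mathfrak{S}(\mathbf{M}_k)$ such that: if $X\subseteq Z_i$ and $Y\subseteq Z_j\subsetneq\mathbf{Fm}_{\mathcal{L}}$, then $Z_i\cap\mathbf{Fm}_{\mathcal{L}}[\mathcal{V}_{\mathcal{L}}\setminus\mathcal{V}(Y)]=Z_k\cap\mathbf{Fm}_{\mathcal{L}}[\mathcal{V}_{\mathcal{L}}\setminus\mathcal{V}(Y)]$ and $Z_j\cap\mathbf{Fm}_{\mathcal{L}}[\mathcal{V}(Y)]\subseteq Z_k$. An atlas is uniform if its corresponding bundle is uniform. -}

module Defs where

open import Data.Nat.Base using (ℕ)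
open import Data.Product.Base using (Σ; Σ-syntax; ∃; ∃-syntax; _×_; _,_; proj₁; proj₂)
open import Data.Vec.Base using (Vec; map)
open import Data.Vec.Properties using (map-id)
open import Data.Vec.Relation.Unary.Any using (Any)
open import Function.Base using (id)
open import Function.Definitions using (Bijective)
import Function.Construct.Identity as Identity
open import Level using (Level; suc; _⊔_)
open import Relation.Binary.PropositionalEquality.Core using (_≡_; refl; cong; sym)
open import Relation.Nullary.Negation.Core using (¬_)
open import Relation.Unary using (Pred; _∈_; _⊆_; _⊂_; _≐_; _∪_; _∩_; ∁; ｛_｝)
  renaming (_⊥_ to Disjoint)
open import Relation.Unary.Polymorphic using (U)

-- A single level ℓ plays the role of "small": variables, constants,
-- connectives and algebras live in Set ℓ, and subsets are predicates valued in
-- Set ℓ. Equality of subsets is mutual inclusion, _≐_.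

private
  variable
    ℓ i : Level

record Language (ℓ : Level) : Set (suc ℓ) where
  field
    Var   : Set ℓ
    Const : Set ℓ
    Conn  : Set ℓ
    arity : Conn → ℕ

record Algebra (L : Language ℓ) : Set (suc ℓ) where
  open Language L
  field
    Carrier : Set ℓ
    const   : Const → Carrier
    conn    : (c : Conn) → Vec Carrier (arity c) → Carrier

open Algebra using (Carrier)

record IsHom {L : Language ℓ} (A B : Algebra L) (h : Carrier A → Carrier B) : Set ℓ where
  open Language L
  private
    module A = Algebra A
    module B = Algebra B
  field
    const-hom : (k : Const) → h (A.const k) ≡ B.const k
    conn-hom  : (c : Conn) (as : Vec A.Carrier (arity c)) →
                h (A.conn c as) ≡ B.conn c (map h as)

Hom : {L : Language ℓ} → Algebra L → Algebra L → Set ℓ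
Hom A B = Σ (Carrier A → Carrier B) (IsHom A B)

infix 4 _≅_

_≅_ : {L : Language ℓ} → Algebra L → Algebra L → Set ℓ
A ≅ B = Σ[ h ∈ Hom A B ] Bijective _≡_ _≡_ (proj₁ h)

id-hom : {L : Language ℓ} (A : Algebra L) → Hom A A
id-hom A = id , record
  { const-hom = λ _ → refl
  ; conn-hom  = λ c as → cong (Algebra.conn A c) (sym (map-id as))
  }

≅-refl : {L : Language ℓ} (A : Algebra L) → A ≅ A
≅-refl A = id-hom A , Identity.bijective _≡_

module _ (L : Language ℓ) where
  open Language L

  data Fm : Set ℓ where
    var   : Var → Fm
    const : Const → Fm
    conn  : (c : Conn) → Vec Fm (arity c) → Fm

  FmAlgebra : Algebra L
  FmAlgebra = record { Carrier = Fm ; const = const ; conn = conn }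

  FmSet : Set (suc ℓ)
  FmSet = Pred Fm ℓ

  AllFm : FmSet
  AllFm = U

  Valuation : Algebra L → Set ℓ
  Valuation A = Hom FmAlgebra A

module _ {L : Language ℓ} where
  open Language L

  data _OccursIn_ (x : Var) : Fm L → Set ℓ where
    here  : x OccursIn var x
    there : ∀ {c αs} → Any (x OccursIn_) αs → x OccursIn conn c αs

  vars : Fm L → Pred Var ℓ
  vars α x = x OccursIn α

  𝒱 : FmSet L → Pred Var ℓ
  𝒱 X x = ∃[ α ] α ∈ X × x ∈ vars α

  Fm[_] : Pred Var ℓ → FmSet L
  Fm[ V ] α = vars α ⊆ V

  image : (Fm L → Fm L) → FmSet L → FmSet L
  image σ X β = ∃[ α ] α ∈ X × σ α ≡ β

record StructuralLogic (L : Language ℓ) : Set (suc ℓ) where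
  infix 3 _⊢_
  field
    _⊢_        : FmSet L → Fm L → Set ℓ
    reflexive  : ∀ {X α} → α ∈ X → X ⊢ α
    monotone   : ∀ {X Y α} → X ⊆ Y → X ⊢ α → Y ⊢ α
    cut        : ∀ {X Y α} → (∀ {β} → β ∈ Y → X ⊢ β) → Y ⊢ α → X ⊢ α
    -- A substitution is an endomorphism of the formula algebra.
    structural : ∀ {X α} ((σ , _) : Hom (FmAlgebra L) (FmAlgebra L)) →
                 X ⊢ α → image σ X ⊢ σ α

  Cn : FmSet L → FmSet L
  Cn X α = X ⊢ α

  IsTheory : FmSet L → Set ℓ
  IsTheory X = Cn X ≐ X

  Theories : Set (suc ℓ)
  Theories = ∃ IsTheory

  Consistent : FmSet L → Set ℓ
  Consistent X = ¬ (Cn X ≐ AllFm L)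

  UniformLogic : Set (suc ℓ)
  UniformLogic =
    ∀ (X Y : FmSet L) (α : Fm L) →
    Disjoint (𝒱 (X ∪ ｛ α ｝)) (𝒱 Y) → Consistent Y →
    X ∪ Y ⊢ α → X ⊢ α

  AllFm-isTheory : IsTheory (AllFm L)
  AllFm-isTheory = (λ _ → _) , reflexive

record Matrix (L : Language ℓ) : Set (suc ℓ) where
  field
    algebra : Algebra L
    filter  : Pred (Carrier algebra) ℓ

𝔖 : {L : Language ℓ} → Matrix L → Pred (FmSet L) ℓ
𝔖 {L = L} M X = Σ[ (v , _) ∈ Valuation L algebra ] X ≐ (λ α → v α ∈ filter)
  where open Matrix M

-- The index type may be larger than ℓ: the theories of a logic form a type in
-- Set (suc ℓ).
record Bundle (L : Language ℓ) (i : Level) : Set (suc (ℓ ⊔ i)) where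
  field
    Index      : Set i
    nonempty   : Index
    matrix     : Index → Matrix L
    isomorphic : ∀ j k → Matrix.algebra (matrix j) ≅ Matrix.algebra (matrix k)

UniformBundle : {L : Language ℓ} → Bundle L i → Set (suc ℓ ⊔ i)
UniformBundle {L = L} 𝔅 =
  ∀ (X Y : FmSet L) → X ⊆ Fm[ ∁ (𝒱 Y) ] →
  ∀ (i j : Index) (Zᵢ Zⱼ : FmSet L) → Zᵢ ∈ 𝔖 (matrix i) → Zⱼ ∈ 𝔖 (matrix j) →
  ∃[ k ] Σ[ Zₖ ∈ FmSet L ] Zₖ ∈ 𝔖 (matrix k) ×
    (X ⊆ Zᵢ → Y ⊆ Zⱼ → Zⱼ ⊂ AllFm L →
      (Zᵢ ∩ Fm[ ∁ (𝒱 Y) ] ≐ Zₖ ∩ Fm[ ∁ (𝒱 Y) ]) ×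
      (Zⱼ ∩ Fm[ 𝒱 Y ] ⊆ Zₖ))
  where open Bundle 𝔅

record Atlas (L : Language ℓ) (i : Level) : Set (suc (ℓ ⊔ i)) where
  field
    algebra  : Algebra L
    Index    : Set i
    nonempty : Index
    filter   : Index → Pred (Carrier algebra) ℓ

bundle : {L : Language ℓ} → Atlas L i → Bundle L i
bundle 𝔄 = record
  { Index      = Index
  ; nonempty   = nonempty
  ; matrix     = λ j → record { algebra = algebra ; filter = filter j }
  ; isomorphic = λ _ _ → ≅-refl algebra
  }
  where open Atlas 𝔄

UniformAtlas : {L : Language ℓ} → Atlas L i → Set (suc ℓ ⊔ i)
UniformAtlas 𝔄 = UniformBundle (bundle 𝔄)

LindenbaumAtlas : {L : Language ℓ} → StructuralLogic L → Atlas L (suc ℓ)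
LindenbaumAtlas {L = L} 𝒮 = record
  { algebra  = FmAlgebra L
  ; Index    = Theories
  ; nonempty = AllFm L , AllFm-isTheory
  ; filter   = proj₁
  }
  where open StructuralLogic 𝒮

{-# OPTIONS --safe #-}
-- Given theories Zᵢ and Zⱼ, take Zₖ = Cn (A ∪ B) with A = Zᵢ ∩ Fm[ ∁ (𝒱 Y) ] and
-- B = Zⱼ ∩ Fm[ 𝒱 Y ]. Then A and B share no variables and B is consistent because
-- Zⱼ ≠ Fm, so uniformity of the logic makes Zₖ conservative over A for formulas
-- without variables of Y.
module Submission where

open import Defs
open import Level using (Level)
open import Data.Product.Base using (_,_; proj₁; proj₂)
open import Data.Sum.Base using (inj₁; inj₂)
open import Function.Base using (id)
open import Relation.Binary.PropositionalEquality.Core using (refl)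
open import Relation.Unary using (Pred; _∈_; _⊆_; _⊂_; _≐_; _∪_; _∩_; ∁; ｛_｝)
  renaming (_⊥_ to Disjoint)

private
  variable
    ℓ : Level

module _ {L : Language ℓ} where

  -- A shared variable would lie both in `V` and outside it; `α` is adjoined to match the premise of
  -- `UniformLogic`.
  Disjoint-𝒱 : ∀ {V : Pred (Language.Var L) ℓ} {P Q : FmSet L} {α} →
               α ∈ Fm[ ∁ V ] →
               Disjoint (𝒱 ((P ∩ Fm[ ∁ V ]) ∪ ｛ α ｝)) (𝒱 (Q ∩ Fm[ V ]))
  Disjoint-𝒱 _ ((_ , inj₁ (_ , β∉V) , x∈β) , (_ , (_ , γ∈V) , x∈γ)) = β∉V x∈β (γ∈V x∈γ)
  Disjoint-𝒱 α∉V ((_ , inj₂ refl , x∈α) , (_ , (_ , γ∈V) , x∈γ)) = α∉V x∈α (γ∈V x∈γ)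

module _ {L : Language ℓ} (𝒮 : StructuralLogic L) where
  open StructuralLogic 𝒮

  Cn-isTheory : ∀ X → IsTheory (Cn X)
  Cn-isTheory X = cut id , reflexive

  ⊆-theory-closed : ∀ {X Z} → Cn Z ⊆ Z → X ⊆ Z → Cn X ⊆ Z
  ⊆-theory-closed Z-closed X⊆Z X⊢α = Z-closed (monotone X⊆Z X⊢α)

  -- Valuations in the formula algebra are substitutions, so `Z` is a preimage of `T` and
  -- structurality pulls closure back.
  𝔖-closed : ∀ {Z} (T : Theories) →
             Z ∈ 𝔖 (record { algebra = FmAlgebra L ; filter = proj₁ T }) → Cn Z ⊆ Z
  𝔖-closed (T , CnT⊆T , _) (σ , Z⊆σ⁻¹T , σ⁻¹T⊆Z) Z⊢α =
    σ⁻¹T⊆Z (⊆-theory-closed CnT⊆T (λ { (_ , β∈Z , refl) → Z⊆σ⁻¹T β∈Z }) (structural σ Z⊢α))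

  ⊆-theory-consistent : ∀ {X Z} → Cn Z ⊆ Z → X ⊆ Z → Z ⊂ AllFm L → Consistent X
  ⊆-theory-consistent Z-closed X⊆Z (_ , All⊈Z) (_ , All⊆CnX) =
    All⊈Z (λ α∈All → ⊆-theory-closed Z-closed X⊆Z (All⊆CnX α∈All))

proposition2p2 : {ℓ : Level} {L : Language ℓ} (𝒮 : StructuralLogic L) →
    StructuralLogic.UniformLogic 𝒮 → UniformAtlas (LindenbaumAtlas 𝒮)
proposition2p2 {L = L} 𝒮 uniform X Y _ i j Zᵢ Zⱼ Zᵢ∈𝔖 Zⱼ∈𝔖 =
  -- The identity valuation exhibits a theory as a member of its own `𝔖`.
  (Cn (A ∪ B) , Cn-isTheory 𝒮 (A ∪ B)) , Cn (A ∪ B) , (id-hom (FmAlgebra L) , id , id) ,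
  λ _ _ Zⱼ⊂All →
    ( (λ α∈A → reflexive (inj₁ α∈A) , λ {x} → proj₂ α∈A {x})
    , (λ { {α} (A∪B⊢α , α∉V) → conservative Zⱼ⊂All α (λ {x} → α∉V {x}) A∪B⊢α , λ {x} → α∉V {x} }))
    , λ α∈B → reflexive (inj₂ α∈B)
  where
  open StructuralLogic 𝒮

  A B : FmSet L
  A = Zᵢ ∩ Fm[ ∁ (𝒱 Y) ]
  B = Zⱼ ∩ Fm[ 𝒱 Y ]

  conservative : Zⱼ ⊂ AllFm L → ∀ α → α ∈ Fm[ ∁ (𝒱 Y) ] → A ∪ B ⊢ α → α ∈ Zᵢ
  conservative Zⱼ⊂All α α∉V A∪B⊢α =
    -- Uniformity discards `B`; what `A` alone entails stays in the closed set `Zᵢ`.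
    ⊆-theory-closed 𝒮 (𝔖-closed 𝒮 i Zᵢ∈𝔖) proj₁
      (uniform A B α (Disjoint-𝒱 {P = Zᵢ} {Q = Zⱼ} α∉V)
        (⊆-theory-consistent 𝒮 (𝔖-closed 𝒮 j Zⱼ∈𝔖) proj₁ Zⱼ⊂All) A∪B⊢α)
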